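{- Let $K$ be a finite field, and let $V$ be a nonzero, finite-dimensional $K$-vector space. Then the finitary double centralizer clone $(\Sigma^V)^{\perp\perp(\aleph_0)}$ of $V$ is equal to the clone of finitary derived operations $\langle \Sigma^V \rangle_{\aleph_0}$ of $V$, where $\Sigma$ is the usual signature for $K$-vector spaces.
   Context: $\Sigma$ is the signature consisting of a binary operation symbol $+$, a constant symbol $0$, a unary operation symbol $-$, and a unary operation symbol $c$ for each $c\in K$ (scalar multiplication by $c$). $\Sigma^V$ denotes the set of the corresponding basic operations on $V$. A finitary operation on a set $A$ is a map $A^n\to A$ with $n$ a finite cardinal ($n=0$ is allowed). A finitary clone on $A$ is a set $F$ of finitary operations on $A$ that contains all projections $\pi_i:A^n\to A$ and is such that for every $f:A^m\to A$ in $F$ and all $g_1,\dots,g_m:A^n\to A$ in $F$, the composite $f\circ(g_1,\dots,g_m):A^n\to A$ lies in $F$. The clone of finitary derived operations $\langle\Sigma^V\rangle_{\aleph_0}$ is the smallest finitary clone on $V$ containing $\Sigma^V$. Operations $f:A^n\to A$ and $g:A^m\to A$ commute, written $f\perp g$, if for every matrix $a=(a_{ij})\in A^{n\times m}$ one has $g\bigl((f((a_{ij})_{i\in n}))_{j\in m}\bigr)=f\bigl((g((a_{ij})_{j\in m}))_{i\in n}\bigr)$. For a set $G$ of finitary operations on $A$, $G^{\perp(\aleph_0)}$ is the set of all finitary operations $f$ on $A$ with $f\perp g$ for all $g\in G$, and $G^{\perp\perp(\aleph_0)}$ is the result of applying $(-)^{\perp(\aleph_0)}$ twice to $G$. -}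

module Defs where

open import Level using (Level; _⊔_; suc)
open import Algebra.Bundles using (CommutativeRing)
import Algebra.Definitions as AlgDefs
import Algebra.Definitions.RawMonoid as RawMonoidDefs
open import Algebra.Module.Bundles using (Module)
open import Data.Fin.Base using (Fin; zero) renaming (suc to fsuc)
open import Data.Nat.Base using (ℕ)
open import Data.Product.Base using (∃; _×_; _,_)
open import Data.Vec.Functional using (Vector)
import Data.Vec.Functional.Relation.Binary.Equality.Setoid as VecEq
open import Function.Bundles using (Func; Inverse)
open import Relation.Binary.Bundles using (Setoid)
import Relation.Binary.PropositionalEquality as ≡
open import Relation.Nullary.Negation using (¬_)
open import Relation.Unary using (Pred; _∈_; _⊆_)

IsFinite : ∀ {a ℓ} → Setoid a ℓ → Set (a ⊔ ℓ)
IsFinite S = ∃ λ n → Inverse (≡.setoid (Fin n)) S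

record IsField {c ℓ} (R : CommutativeRing c ℓ) : Set (c ⊔ ℓ) where
  open CommutativeRing R
  open AlgDefs _≈_ using (Invertible)
  field
    1≉0     : ¬ (1# ≈ 0#)
    inverse : ∀ x → ¬ (x ≈ 0#) → Invertible 1# _*_ x

module _ {c ℓ m ℓm} {K : CommutativeRing c ℓ} (V : Module K m ℓm) where
  open CommutativeRing K using (Carrier; _≈_; 0#)
  open Module V
  open RawMonoidDefs +ᴹ-rawMonoid using (sum)

  linearCombination : ∀ {d} → Vector Carrier d → Vector Carrierᴹ d → Carrierᴹ
  linearCombination k b = sum (λ i → k i *ₗ b i)

  record IsBasis {d : ℕ} (b : Vector Carrierᴹ d) : Set (c ⊔ ℓ ⊔ m ⊔ ℓm) where
    field
      spans       : ∀ v → ∃ λ (k : Vector Carrier d) → v ≈ᴹ linearCombination k b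
      independent : ∀ (k : Vector Carrier d) →
                    linearCombination k b ≈ᴹ 0ᴹ → ∀ i → k i ≈ 0#

  FiniteDimensional : Set (c ⊔ ℓ ⊔ m ⊔ ℓm)
  FiniteDimensional = ∃ λ (d : ℕ) → ∃ λ (b : Vector Carrierᴹ d) → IsBasis b

  Nonzero : Set (m ⊔ ℓm)
  Nonzero = ∃ λ (v : Carrierᴹ) → ¬ (v ≈ᴹ 0ᴹ)

module Clones {a ℓ} (S : Setoid a ℓ) where
  open Setoid S renaming (Carrier to A)
  open VecEq S using (≋-setoid)

  -- The set is the setoid S, so a map Aⁿ → A is one that respects equality.
  Op : ℕ → Set (a ⊔ ℓ)
  Op n = Func (≋-setoid n) S

  apply : ∀ {n} → Op n → Vector A n → A
  apply = Func.to

  infix 4 _≗_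
  _≗_ : ∀ {n} → Op n → Op n → Set (a ⊔ ℓ)
  f ≗ g = ∀ x → apply f x ≈ apply g x

  OpSet : (p : Level) → Set (a ⊔ ℓ ⊔ suc p)
  OpSet p = (n : ℕ) → Pred (Op n) p

  π : ∀ {n} → Fin n → Op n
  π i = record { to = λ x → x i ; cong = λ x≋y → x≋y i }

  infixr 9 _⊚_
  _⊚_ : ∀ {m n} → Op m → (Fin m → Op n) → Op n
  f ⊚ g = record
    { to   = λ x → apply f (λ i → apply (g i) x)
    ; cong = λ x≋y → Func.cong f (λ i → Func.cong (g i) x≋y)
    }

  -- The field respects says that F is a set of operations up to _≗_, which
  -- plays the role of equality of operations.
  record IsClone {p} (F : OpSet p) : Set (a ⊔ ℓ ⊔ p) where
    field
      respects    : ∀ {n} {f g : Op n} → f ≗ g → f ∈ F n → g ∈ F n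
      projections : ∀ {n} (i : Fin n) → π i ∈ F n
      composites  : ∀ {m n} {f : Op m} {g : Fin m → Op n} →
                    f ∈ F m → (∀ i → g i ∈ F n) → (f ⊚ g) ∈ F n

  -- ⟨ G ⟩ is the smallest clone containing G: see ⟨⟩-isClone, ⟨⟩-contains
  -- and ⟨⟩-least.
  data ⟨_⟩ {p} (G : OpSet p) : OpSet (a ⊔ ℓ ⊔ p) where
    basic : ∀ {n} {f : Op n} → f ∈ G n → f ∈ ⟨ G ⟩ n
    resp  : ∀ {n} {f g : Op n} → f ≗ g → f ∈ ⟨ G ⟩ n → g ∈ ⟨ G ⟩ n
    proj  : ∀ {n} (i : Fin n) → π i ∈ ⟨ G ⟩ n
    comp  : ∀ {m n} {f : Op m} {g : Fin m → Op n} →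
            f ∈ ⟨ G ⟩ m → (∀ i → g i ∈ ⟨ G ⟩ n) → (f ⊚ g) ∈ ⟨ G ⟩ n

  ⟨⟩-isClone : ∀ {p} (G : OpSet p) → IsClone ⟨ G ⟩
  ⟨⟩-isClone G = record { respects = resp ; projections = proj ; composites = comp }

  ⟨⟩-contains : ∀ {p} (G : OpSet p) n → G n ⊆ ⟨ G ⟩ n
  ⟨⟩-contains G n = basic

  ⟨⟩-least : ∀ {p q} (G : OpSet p) (F : OpSet q) → IsClone F →
             (∀ n → G n ⊆ F n) → ∀ n → ⟨ G ⟩ n ⊆ F n
  ⟨⟩-least G F F-clone G⊆F = go
    where
    open IsClone F-clone
    go : ∀ n → ⟨ G ⟩ n ⊆ F n
    go n (basic f∈G)   = G⊆F n f∈G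
    go n (resp eq f∈)  = respects eq (go n f∈)
    go n (proj i)      = projections i
    go n (comp f∈ g∈)  = composites (go _ f∈) (λ i → go n (g∈ i))

  infix 4 _⊥_
  _⊥_ : ∀ {n m} → Op n → Op m → Set (a ⊔ ℓ)
  _⊥_ {n} {m} f g = ∀ (x : Fin n → Fin m → A) →
    apply g (λ j → apply f (λ i → x i j)) ≈ apply f (λ i → apply g (λ j → x i j))

  infix 10 _^⊥ _^⊥⊥
  _^⊥ : ∀ {p} → OpSet p → OpSet (a ⊔ ℓ ⊔ p)
  (G ^⊥) n f = ∀ m (g : Op m) → g ∈ G m → f ⊥ g

  _^⊥⊥ : ∀ {p} → OpSet p → OpSet (a ⊔ ℓ ⊔ p)
  G ^⊥⊥ = (G ^⊥) ^⊥

module _ {c ℓ} (K : CommutativeRing c ℓ) where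
  open CommutativeRing K using (Carrier)

  data Symbol : Set c where
    plus : Symbol
    nil  : Symbol
    neg  : Symbol
    scal : Carrier → Symbol

  arity : Symbol → ℕ
  arity plus     = 2
  arity nil      = 0
  arity neg      = 1
  arity (scal _) = 1

module _ {c ℓ m ℓm} {K : CommutativeRing c ℓ} (V : Module K m ℓm) where
  open Module V
  open CommutativeRing K using (refl)
  open Clones ≈ᴹ-setoid

  ⟦_⟧ : (σ : Symbol K) → Op (arity K σ)
  ⟦ plus ⟧ = record
    { to   = λ x → x zero +ᴹ x (fsuc zero)
    ; cong = λ x≋y → +ᴹ-cong (x≋y zero) (x≋y (fsuc zero)) }
  ⟦ nil ⟧ = record
    { to   = λ _ → 0ᴹ
    ; cong = λ _ → ≈ᴹ-refl }
  ⟦ neg ⟧ = record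
    { to   = λ x → -ᴹ x zero
    ; cong = λ x≋y → -ᴹ‿cong (x≋y zero) }
  ⟦ scal k ⟧ = record
    { to   = λ x → k *ₗ x zero
    ; cong = λ x≋y → *ₗ-cong refl (x≋y zero) }

  data BasicOperations : OpSet (c ⊔ m ⊔ ℓm) where
    interpretation : ∀ (σ : Symbol K) {f : Op (arity K σ)} →
                     f ≗ ⟦ σ ⟧ → f ∈ BasicOperations (arity K σ)

{-# OPTIONS --safe #-}
-- Let f commute with every linear operation and fix x ∈ Vⁿ. Let φ be the first coordinate
-- functional of a basis b of V, and let a be the matrix with entries aᵢⱼ = δᵢⱼ b₀. The
-- operation g(y) = Σⱼ φ(yⱼ) xⱼ is linear and sends the i-th row of a to xᵢ, so commuting f
-- with g on a gives f(x) = Σⱼ φ(f(j-th column of a)) xⱼ, whose coefficients do not depend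
-- on x. Conversely, a double centralizer is a clone containing the operations it starts from.
module Submission where

open import Defs
open import Level using (Level; _⊔_)
open import Algebra.Bundles using (CommutativeRing)
open import Algebra.Module.Bundles using (Module)
import Algebra.Module.Properties as ModuleProperties
import Algebra.Properties.CommutativeMonoid.Sum as Sum
import Algebra.Properties.Group as GroupProperties
open import Data.Empty using (⊥-elim)
open import Data.Fin.Base using (Fin; zero; suc)
open import Data.Nat.Base using (ℕ; zero; suc)
open import Data.Product.Base using (∃; _×_; _,_; proj₁; proj₂)
open import Data.Vec.Functional using (Vector; []; _∷_)
open import Function.Base using (_∘_; flip)
open import Function.Bundles using (Func)
open import Relation.Binary.Bundles using (Setoid)
import Relation.Binary.Reasoning.Setoid as SetoidReasoning
open import Relation.Unary using (_∈_; _⊆_; _≐_)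

module Centralizer {a ℓ} (S : Setoid a ℓ) where
  open Setoid S
  open Clones S

  -- Transposing the matrix swaps the two sides of the commutation equation.
  ⊥-sym : ∀ {n m} {f : Op n} {g : Op m} → f ⊥ g → g ⊥ f
  ⊥-sym f⊥g x = sym (f⊥g (flip x))

  ⊥-respʳ : ∀ {n m} {f : Op n} {g h : Op m} → h ≗ g → f ⊥ g → f ⊥ h
  ⊥-respʳ {f = f} h≗g f⊥g x =
    trans (h≗g _) (trans (f⊥g x) (sym (Func.cong f (λ i → h≗g (x i)))))

  ⊥-respˡ : ∀ {n m} {f g : Op n} {h : Op m} → f ≗ g → f ⊥ h → g ⊥ h
  ⊥-respˡ {h = h} f≗g f⊥h x =
    trans (Func.cong h (λ j → sym (f≗g (λ i → x i j)))) (trans (f⊥h x) (f≗g _))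

  ^⊥-isClone : ∀ {p} (G : OpSet p) → IsClone (G ^⊥)
  ^⊥-isClone G = record
    { respects    = λ {n} {f} {g} f≗g f∈ m h h∈ →
                      ⊥-respˡ {f = f} {g} {h} f≗g (f∈ m h h∈)
    ; projections = λ i m h h∈ x → refl
    ; composites  = λ {_} {_} {f} {g} f∈ g∈ m h h∈ x →
                      -- First `h` moves past `f`, on the matrix whose i-th row holds the values of
                      -- `g i` at the columns of `x`; then it moves past each `g i`.
                      trans (f∈ m h h∈ (λ i j → apply (g i) (λ k → x k j)))
                            (Func.cong f (λ i → g∈ i m h h∈ x))
    }

  ⊆-^⊥⊥ : ∀ {p} (G : OpSet p) n → G n ⊆ (G ^⊥⊥) n
  ⊆-^⊥⊥ G n {g} g∈ m f f∈ = ⊥-sym {f = f} {g} (f∈ n g g∈)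

  -- The double centralizer is itself a centralizer, that of `G ^⊥`, so `^⊥-isClone` makes it a
  -- clone and minimality of `⟨ G ⟩` applies.
  ⟨⟩⊆^⊥⊥ : ∀ {p} (G : OpSet p) n → ⟨ G ⟩ n ⊆ (G ^⊥⊥) n
  ⟨⟩⊆^⊥⊥ G = ⟨⟩-least G (G ^⊥⊥) (^⊥-isClone (G ^⊥)) (⊆-^⊥⊥ G)

module LinearCombination {c ℓ m ℓm} {K : CommutativeRing c ℓ} (V : Module K m ℓm) where
  open CommutativeRing K hiding (zero)
  open Module V
  open Sum +ᴹ-commutativeMonoid using (sum-cong-≋; ∑-distrib-+)
  open GroupProperties +-group using (x∙y⁻¹≈ε⇒x≈y)
  open Clones ≈ᴹ-setoid
  open SetoidReasoning ≈ᴹ-setoid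

  lc : ∀ {d} → Vector Carrier d → Vector Carrierᴹ d → Carrierᴹ
  lc = linearCombination V

  lc-cong : ∀ {d} {k k′ : Vector Carrier d} {x x′ : Vector Carrierᴹ d} →
            (∀ i → k i ≈ k′ i) → (∀ i → x i ≈ᴹ x′ i) → lc k x ≈ᴹ lc k′ x′
  lc-cong k≈ x≈ = sum-cong-≋ (λ i → *ₗ-cong (k≈ i) (x≈ i))

  lc-congˡ : ∀ {d} {k k′ : Vector Carrier d} (x : Vector Carrierᴹ d) →
             (∀ i → k i ≈ k′ i) → lc k x ≈ᴹ lc k′ x
  lc-congˡ x k≈ = lc-cong k≈ (λ i → ≈ᴹ-refl)

  lc-+ : ∀ {d} (k k′ : Vector Carrier d) (x : Vector Carrierᴹ d) →
         lc (λ i → k i + k′ i) x ≈ᴹ lc k x +ᴹ lc k′ x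
  lc-+ k k′ x = ≈ᴹ-trans (sum-cong-≋ (λ i → *ₗ-distribʳ (x i) (k i) (k′ i)))
                         (∑-distrib-+ (λ i → k i *ₗ x i) (λ i → k′ i *ₗ x i))

  lc-* : ∀ {d} s (k : Vector Carrier d) (x : Vector Carrierᴹ d) →
         lc (λ i → s * k i) x ≈ᴹ s *ₗ lc k x
  lc-* {zero}  s k x = ≈ᴹ-sym (*ₗ-zeroʳ s)
  lc-* {suc d} s k x =
    ≈ᴹ-trans (+ᴹ-cong (*ₗ-assoc s (k zero) (x zero)) (lc-* s (k ∘ suc) (x ∘ suc)))
             (≈ᴹ-sym (*ₗ-distribˡ s _ _))

  lc-0 : ∀ {d} (x : Vector Carrierᴹ d) → lc (λ _ → 0#) x ≈ᴹ 0ᴹ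
  lc-0 {zero}  x = ≈ᴹ-refl
  lc-0 {suc d} x = ≈ᴹ-trans (+ᴹ-cong (*ₗ-zeroˡ _) (lc-0 (x ∘ suc))) (+ᴹ-identityˡ 0ᴹ)

  -- The Kronecker delta, by recursion on the index rather than by deciding equality, so that `lc-δ`
  -- follows by the same recursion.
  δ : ∀ {d} → Fin d → Vector Carrier d
  δ zero    = 1# ∷ λ _ → 0#
  δ (suc i) = 0# ∷ δ i

  lc-δ : ∀ {d} (i : Fin d) (x : Vector Carrierᴹ d) → lc (δ i) x ≈ᴹ x i
  lc-δ zero    x = ≈ᴹ-trans (+ᴹ-cong (*ₗ-identityˡ _) (lc-0 (x ∘ suc))) (+ᴹ-identityʳ _)
  lc-δ (suc i) x = ≈ᴹ-trans (+ᴹ-cong (*ₗ-zeroˡ _) (lc-δ i (x ∘ suc))) (+ᴹ-identityˡ _)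

  record IsLinearFunctional (φ : Carrierᴹ → Carrier) : Set (c ⊔ ℓ ⊔ m ⊔ ℓm) where
    field
      φ-cong : ∀ {u v} → u ≈ᴹ v → φ u ≈ φ v
      φ-+    : ∀ u v → φ (u +ᴹ v) ≈ φ u + φ v
      φ-*    : ∀ s v → φ (s *ₗ v) ≈ s * φ v

  module Coordinates {d} {b : Vector Carrierᴹ d} (isBasis : IsBasis V b) where
    open IsBasis isBasis

    -- The coefficients are read off the witness chosen by `spans`; that this choice respects `≈ᴹ`
    -- follows only from independence, through `coord-unique`.
    coord : Fin d → Carrierᴹ → Carrier
    coord i v = proj₁ (spans v) i

    -- Independence is applied to the difference of the two coefficient families.
    lc-injective : ∀ {k k′} → lc k b ≈ᴹ lc k′ b → ∀ i → k i ≈ k′ i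
    lc-injective {k} {k′} eq i = x∙y⁻¹≈ε⇒x≈y (k i) (k′ i) (independent _ lc-diff≈0 i)
      where
      lc-diff≈0 : lc (λ i → k i - k′ i) b ≈ᴹ 0ᴹ
      lc-diff≈0 = begin
        lc (λ i → k i - k′ i) b            ≈⟨ lc-+ k (λ i → - k′ i) b ⟩
        lc k b +ᴹ lc (λ i → - k′ i) b      ≈⟨ +ᴹ-congʳ eq ⟩
        lc k′ b +ᴹ lc (λ i → - k′ i) b     ≈⟨ lc-+ k′ (λ i → - k′ i) b ⟨
        lc (λ i → k′ i - k′ i) b           ≈⟨ lc-congˡ b (λ i → -‿inverseʳ (k′ i)) ⟩
        lc (λ _ → 0#) b                    ≈⟨ lc-0 b ⟩
        0ᴹ                                 ∎

    -- Any expansion of `v` in the basis reveals its coordinates; linearity of `coord i` and its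
    -- values on the basis are instances.
    coord-unique : ∀ {k v} → v ≈ᴹ lc k b → ∀ i → coord i v ≈ k i
    coord-unique {v = v} eq = lc-injective (≈ᴹ-trans (≈ᴹ-sym (proj₂ (spans v))) eq)

    coord-isLinear : ∀ i → IsLinearFunctional (coord i)
    coord-isLinear i = record
      { φ-cong = λ {u} {v} u≈v → coord-unique (≈ᴹ-trans u≈v (proj₂ (spans v))) i
      ; φ-+    = λ u v → coord-unique
          (≈ᴹ-trans (+ᴹ-cong (proj₂ (spans u)) (proj₂ (spans v))) (≈ᴹ-sym (lc-+ _ _ b))) i
      ; φ-*    = λ s v → coord-unique
          (≈ᴹ-trans (*ₗ-congˡ (proj₂ (spans v))) (≈ᴹ-sym (lc-* s _ b))) i
      }

    coord-basis : ∀ i j → coord j (b i) ≈ δ i j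
    coord-basis i = coord-unique (≈ᴹ-sym (lc-δ i b))

module _ {c ℓ m ℓm} {K : CommutativeRing c ℓ} (V : Module K m ℓm) where
  open CommutativeRing K hiding (zero)
  open Module V
  open ModuleProperties V using (inverseˡ-uniqueᴹ)
  open LinearCombination V
  open Clones ≈ᴹ-setoid
  open Centralizer ≈ᴹ-setoid
  open SetoidReasoning ≈ᴹ-setoid

  combination : ∀ {d n} → Vector Carrier d → (Fin d → Op n) → Op n
  combination k h = record
    { to   = λ x → lc k (λ i → apply (h i) x)
    ; cong = λ x≋y → lc-cong (λ i → refl) (λ i → Func.cong (h i) x≋y)
    }

  combination∈⟨⟩ : ∀ {d n} (k : Vector Carrier d) {h : Fin d → Op n} →
                   (∀ i → h i ∈ ⟨ BasicOperations V ⟩ n) →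
                   combination k h ∈ ⟨ BasicOperations V ⟩ n
  combination∈⟨⟩ {zero}  k h∈ =
    -- The composite and the combination have the same values by computation, but as records they
    -- also carry `cong` proofs; `resp` compares values only.
    resp (λ x → ≈ᴹ-refl)
      (comp {f = ⟦_⟧ V nil} {g = []} (basic (interpretation nil (λ x → ≈ᴹ-refl))) (λ ()))
  combination∈⟨⟩ {suc d} {n} k {h} h∈ =
    resp (λ x → ≈ᴹ-refl)
      (comp {f = ⟦_⟧ V plus} {g = summands} (basic (interpretation plus (λ x → ≈ᴹ-refl))) summands∈)
    where
    summands : Fin 2 → Op n
    summands = (⟦_⟧ V (scal (k zero)) ⊚ λ _ → h zero) ∷ combination (k ∘ suc) (h ∘ suc) ∷ []

    summands∈ : ∀ i → summands i ∈ ⟨ BasicOperations V ⟩ n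
    summands∈ zero       =
      comp {f = ⟦_⟧ V (scal (k zero))}
           (basic (interpretation (scal (k zero)) (λ x → ≈ᴹ-refl))) (λ _ → h∈ zero)
    summands∈ (suc zero) = combination∈⟨⟩ (k ∘ suc) (h∈ ∘ suc)

  -- The two remaining symbols follow: zero is `0# *ₗ 0ᴹ`, and negatives are determined by addition
  -- and zero.
  preserves-+-*⇒∈^⊥ : ∀ {n} (g : Op n) →
    (∀ x y → apply g (λ i → x i +ᴹ y i) ≈ᴹ apply g x +ᴹ apply g y) →
    (∀ s x → apply g (λ i → s *ₗ x i) ≈ᴹ s *ₗ apply g x) →
    g ∈ (BasicOperations V ^⊥) n
  preserves-+-*⇒∈^⊥ g g-+ g-* _ h (interpretation σ h≗σ) =
    ⊥-respʳ {f = g} {⟦_⟧ V σ} {h} h≗σ (commutes σ)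
    where
    g-0 : apply g (λ _ → 0ᴹ) ≈ᴹ 0ᴹ
    g-0 = begin
      apply g (λ _ → 0ᴹ)        ≈⟨ Func.cong g (λ _ → *ₗ-zeroˡ 0ᴹ) ⟨
      apply g (λ _ → 0# *ₗ 0ᴹ)  ≈⟨ g-* 0# (λ _ → 0ᴹ) ⟩
      0# *ₗ apply g (λ _ → 0ᴹ)  ≈⟨ *ₗ-zeroˡ _ ⟩
      0ᴹ                        ∎

    g-neg : ∀ x → apply g (λ i → -ᴹ x i) ≈ᴹ -ᴹ apply g x
    g-neg x = inverseˡ-uniqueᴹ _ _ (begin
      apply g (λ i → -ᴹ x i) +ᴹ apply g x  ≈⟨ g-+ _ x ⟨
      apply g (λ i → -ᴹ x i +ᴹ x i)        ≈⟨ Func.cong g (λ i → -ᴹ‿inverseˡ (x i)) ⟩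
      apply g (λ _ → 0ᴹ)                   ≈⟨ g-0 ⟩
      0ᴹ                                   ∎)

    commutes : ∀ σ → g ⊥ ⟦_⟧ V σ
    commutes plus     x = ≈ᴹ-sym (g-+ _ _)
    commutes nil      x = ≈ᴹ-sym g-0
    commutes neg      x = ≈ᴹ-sym (g-neg _)
    commutes (scal s) x = ≈ᴹ-sym (g-* s _)

  module _ {φ : Carrierᴹ → Carrier} (φ-linear : IsLinearFunctional φ) where
    open IsLinearFunctional φ-linear

    -- Here the vectors `x` are fixed and the argument `y` supplies the scalars through `φ`; for n =
    -- 1 this is the endomorphism y ↦ φ(y)x.
    functionalCombination : ∀ {n} → Vector Carrierᴹ n → Op n
    functionalCombination x = record
      { to   = λ y → lc (φ ∘ y) x
      ; cong = λ y≋z → lc-congˡ x (λ i → φ-cong (y≋z i))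
      }

    functionalCombination∈^⊥ : ∀ {n} (x : Vector Carrierᴹ n) →
      functionalCombination x ∈ (BasicOperations V ^⊥) n
    functionalCombination∈^⊥ x = preserves-+-*⇒∈^⊥ (functionalCombination x)
      (λ y z → ≈ᴹ-trans (lc-congˡ x (λ i → φ-+ (y i) (z i))) (lc-+ _ _ x))
      (λ s y → ≈ᴹ-trans (lc-congˡ x (λ i → φ-* s (y i))) (lc-* s _ x))

    ^⊥⊥⊆⟨⟩ : ∀ {v} → φ v ≈ 1# → ∀ n →
             (BasicOperations V ^⊥⊥) n ⊆ ⟨ BasicOperations V ⟩ n
    ^⊥⊥⊆⟨⟩ {v} φv≈1 n {f} f∈ =
      -- With the projections as operands, the combination takes the value `lc coefficient x` at
      -- `x`.
      resp (λ x → ≈ᴹ-sym (f-expansion x)) (combination∈⟨⟩ coefficient proj)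
      where
      coefficient : Vector Carrier n
      coefficient j = φ (apply f (λ i → δ i j *ₗ v))

      f-expansion : ∀ x → apply f x ≈ᴹ lc coefficient x
      f-expansion x = begin
        apply f x
          ≈⟨ Func.cong f (λ i → lc-δ i x) ⟨
        apply f (λ i → lc (δ i) x)
          ≈⟨ Func.cong f (λ i → lc-congˡ x (λ j → φδv≈δ i j)) ⟨
        apply f (λ i → lc (λ j → φ (δ i j *ₗ v)) x)
          -- Commutation, read from right to left: `φ` turns the matrix `δ i j *ₗ v` into the
          -- identity matrix, so its rows yield the `x i`, while applying `f` to its columns yields
          -- the coefficients.
          ≈⟨ f∈ n (functionalCombination x) (functionalCombination∈^⊥ x) (λ i j → δ i j *ₗ v) ⟨
        lc coefficient x
          ∎
        where
        φδv≈δ : ∀ i j → φ (δ i j *ₗ v) ≈ δ i j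
        φδv≈δ i j = trans (φ-* (δ i j) v) (trans (*-congˡ φv≈1) (*-identityʳ (δ i j)))

  existsNormalizedFunctional : FiniteDimensional V → Nonzero V →
    ∃ λ φ → IsLinearFunctional φ × ∃ λ v → φ v ≈ 1#
  existsNormalizedFunctional (zero , b , isBasis) (v , v≉0) =
    -- With an empty basis, `spans` equates `v` with the empty sum, which is `0ᴹ`.
    ⊥-elim (v≉0 (proj₂ (IsBasis.spans isBasis v)))
  existsNormalizedFunctional (suc d , b , isBasis) _ =
    -- The first coordinate of the first basis vector is `δ zero zero`, which computes to `1#`.
    coord zero , coord-isLinear zero , b zero , coord-basis zero zero
    where open Coordinates isBasis

theorem7p2 : {c ℓ m ℓm : Level} (K : CommutativeRing c ℓ) →
    IsField K → IsFinite (CommutativeRing.setoid K) →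
    (V : Module K m ℓm) → FiniteDimensional V → Nonzero V →
    let open Clones (Module.≈ᴹ-setoid V) in
    (n : ℕ) → (BasicOperations V ^⊥⊥) n ≐ ⟨ BasicOperations V ⟩ n
theorem7p2 K _ _ V V-finite V-nonzero n =
  let φ , φ-linear , v , φv≈1 = existsNormalizedFunctional V V-finite V-nonzero
  in ^⊥⊥⊆⟨⟩ V φ-linear φv≈1 n
   , Centralizer.⟨⟩⊆^⊥⊥ (Module.≈ᴹ-setoid V) (BasicOperations V) n
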